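{- Let $U$ be a nonempty finite set and $\mathcal{B}$ a Boolean sublattice of $\mathrm{Part}(U)$. (i) If $\nabla\notin\mathcal{B}$, then $\mathcal{B}$ is contained in a strictly larger Boolean sublattice $\mathcal{B}'$ of $\mathrm{Part}(U)$. (ii) If $\nabla\in\mathcal{B}$ but $\triangle\notin\mathcal{B}$, then $\mathcal{B}$ is contained in a strictly larger Boolean sublattice $\mathcal{B}'$ of $\mathrm{Part}(U)$.
   Context: $\mathrm{Part}(U)$ is the lattice of all partitions of $U$ ordered by refinement; $\triangle$ is its least element (all blocks singletons) and $\nabla$ its greatest element (single block $U$). A Boolean sublattice of $\mathrm{Part}(U)$ is a sublattice (closed under meet and join of $\mathrm{Part}(U)$) that is itself a Boolean lattice with respect to its own least and greatest elements, which need not be $\triangle$ and $\nabla$. -}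

module Defs where

open import Level using (Level; 0ℓ; _⊔_; suc)
open import Algebra.Core using (Op₁; Op₂)
open import Algebra.Lattice.Structures using (IsBooleanAlgebra)
open import Data.Bool.Properties using (T-≡)
open import Data.Fin.Base using (Fin)
open import Data.Fin.Subset using (Subset; Nonempty; ⁅_⁆; _∩_; ∁)
  renaming (_∈_ to _∈ˢ_; _⊆_ to _⊆ˢ_; ⊤ to full)
open import Data.Fin.Subset.Properties
  using (_∈?_; anySubset?; ⊆-antisym; ⊆-trans; x∈⁅x⁆; x∈⁅y⁆⇒x≡y; ∈⊤; ⊆⊤;
         x∈p∩q⁺; x∈p∩q⁻; p∩q⊆p; p∩q⊆q; x∈p⇒x∉∁p; x∈∁p⇒x∉p; x∉p⇒x∈∁p)
open import Data.Fin.Properties using (all?)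
import Data.Fin.Base as Fin
open import Data.Nat.Base using (ℕ; NonZero)
import Data.Nat.Base as ℕ
open import Data.Product.Base using (Σ; ∃; _×_; _,_; proj₁; proj₂)
open import Data.Vec.Base using (tabulate)
open import Data.Vec.Properties using (lookup∘tabulate; []=⇒lookup; lookup⇒[]=)
open import Function.Base using (_∘_; _on_; id)
open import Function.Bundles using (Equivalence)
open import Relation.Binary.Core using (Rel)
open import Relation.Binary.Definitions
  using (Decidable; Maximum; Minimum; _Respects_)
open import Relation.Binary.Lattice.Bundles using (Lattice)
open import Relation.Binary.Lattice.Definitions using (Infimum; Supremum)
open import Relation.Binary.PropositionalEquality.Core
  using (_≡_; refl; sym; trans; subst)
open import Relation.Binary.Structures
  using (IsDecEquivalence; IsPartialOrder)
open import Relation.Nullary.Decidable.Core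
  using (Dec; ⌊_⌋; toWitness; fromWitness; ¬?; _×-dec_; _→-dec_;
         decidable-stable)
open import Relation.Unary using (Pred; _∈_; _≐_)
open import Relation.Unary.Properties using (≐-refl; ≐-sym; ≐-trans)

private
  variable
    n : ℕ

record Partition (n : ℕ) : Set₁ where
  field
    IsBlock  : Pred (Subset n) 0ℓ
    nonempty : ∀ {p} → IsBlock p → Nonempty p
    cover    : ∀ x → ∃ λ p → IsBlock p × x ∈ˢ p
    disjoint : ∀ {p q} → IsBlock p → IsBlock q → Nonempty (p ∩ q) → p ≡ q

  same : ∀ {p q x} → IsBlock p → IsBlock q → x ∈ˢ p → x ∈ˢ q → p ≡ q
  same P Q x∈p x∈q = disjoint P Q (_ , x∈p∩q⁺ (x∈p , x∈q))

open Partition using (IsBlock)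

infix 4 _≈_ _≤_

_≈_ : Rel (Partition n) 0ℓ
π ≈ σ = IsBlock π ≐ IsBlock σ

-- Finer partitions are smaller.
_≤_ : Rel (Partition n) 0ℓ
π ≤ σ = ∀ {p} → IsBlock π p → ∃ λ q → IsBlock σ q × p ⊆ˢ q

≤-isPartialOrder : IsPartialOrder (_≈_ {n}) _≤_
≤-isPartialOrder = record
  { isPreorder = record
    { isEquivalence = record { refl = ≐-refl ; sym = ≐-sym ; trans = ≐-trans }
    ; reflexive     = λ π≈σ P → _ , proj₁ π≈σ P , id
    ; trans         = λ π≤σ σ≤ρ P →
        let q , Q , p⊆q = π≤σ P
            r , R , q⊆r = σ≤ρ Q
        in  r , R , ⊆-trans p⊆q q⊆r
    }
  ; antisym = λ {π} {σ} π≤σ σ≤π → half {π = π} {σ} π≤σ σ≤π , half {π = σ} {π} σ≤π π≤σ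
  }
  where
  half : ∀ {π σ : Partition n} → π ≤ σ → σ ≤ π →
         ∀ {p} → IsBlock π p → IsBlock σ p
  half {π = π} {σ} π≤σ σ≤π {p} P
    with q , Q , p⊆q ← π≤σ P
    with r , R , q⊆r ← σ≤π Q
    with x , x∈p ← Partition.nonempty π P
    with refl ← Partition.same π P R x∈p (q⊆r (p⊆q x∈p))
    = subst (IsBlock σ) (⊆-antisym q⊆r p⊆q) Q

△ : Partition n
△ = record
  { IsBlock  = λ p → ∃ λ x → p ≡ ⁅ x ⁆
  ; nonempty = λ { (x , refl) → x , x∈⁅x⁆ x }
  ; cover    = λ x → ⁅ x ⁆ , (x , refl) , x∈⁅x⁆ x
  ; disjoint = λ { (x , refl) (y , refl) (z , z∈) →
      let z∈x , z∈y = x∈p∩q⁻ ⁅ x ⁆ ⁅ y ⁆ z∈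
      in  trans (sym (≡⁅⁆ z∈x)) (≡⁅⁆ z∈y) }
  }
  where
  ≡⁅⁆ : ∀ {x z : Fin n} → z ∈ˢ ⁅ x ⁆ → ⁅ z ⁆ ≡ ⁅ x ⁆
  ≡⁅⁆ {x = x} z∈ with refl ← x∈⁅y⁆⇒x≡y x z∈ = refl

∇ : .{{_ : NonZero n}} → Partition n
∇ {n = ℕ.suc n} = record
  { IsBlock  = λ p → p ≡ full
  ; nonempty = λ { refl → Fin.zero , ∈⊤ }
  ; cover    = λ x → full , refl , ∈⊤
  ; disjoint = λ { refl refl _ → refl }
  }

△-minimum : Minimum (_≤_ {n}) △
△-minimum σ (x , refl) =
  let q , Q , x∈q = Partition.cover σ x
  in  q , Q , λ y∈ → subst (_∈ˢ q) (sym (x∈⁅y⁆⇒x≡y x y∈)) x∈q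

∇-maximum : .{{_ : NonZero n}} → Maximum (_≤_ {n}) ∇
∇-maximum {n = ℕ.suc n} π _ = full , refl , ⊆⊤

infixr 7 _∧_
infixr 6 _∨_

_∧_ : Op₂ (Partition n)
π ∧ σ = record
  { IsBlock  = λ r → Nonempty r ×
      ∃ λ p → ∃ λ q → IsBlock π p × IsBlock σ q × r ≡ p ∩ q
  ; nonempty = proj₁
  ; cover    = λ x →
      let p , P , x∈p = Partition.cover π x
          q , Q , x∈q = Partition.cover σ x
          x∈p∩q = x∈p∩q⁺ (x∈p , x∈q)
      in  p ∩ q , ((x , x∈p∩q) , p , q , P , Q , refl) , x∈p∩q
  ; disjoint = λ { (_ , p , q , P , Q , refl) (_ , p′ , q′ , P′ , Q′ , refl) (x , x∈) →
      disj P Q P′ Q′ (x∈p∩q⁻ (p ∩ q) (p′ ∩ q′) x∈) }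
  }
  where
  disj : ∀ {p q p′ q′ x} → IsBlock π p → IsBlock σ q → IsBlock π p′ → IsBlock σ q′ →
         x ∈ˢ p ∩ q × x ∈ˢ p′ ∩ q′ → p ∩ q ≡ p′ ∩ q′
  disj {p} {q} {p′} {q′} P Q P′ Q′ (x∈ , x∈′)
    with x∈p , x∈q ← x∈p∩q⁻ p q x∈
    with x∈p′ , x∈q′ ← x∈p∩q⁻ p′ q′ x∈′
    with refl ← Partition.same π P P′ x∈p x∈p′
    with refl ← Partition.same σ Q Q′ x∈q x∈q′
    = refl

∧-infimum : Infimum (_≤_ {n}) _∧_
∧-infimum π σ =
    (λ { (_ , p , q , P , Q , refl) → p , P , p∩q⊆p p q })
  , (λ { (_ , p , q , P , Q , refl) → q , Q , p∩q⊆q p q })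
  , λ ρ ρ≤π ρ≤σ R →
      let p , P , r⊆p = ρ≤π R
          q , Q , r⊆q = ρ≤σ R
          x , x∈r = Partition.nonempty ρ R
          r⊆p∩q = λ {y} y∈r → x∈p∩q⁺ {x = y} (r⊆p y∈r , r⊆q y∈r)
      in  p ∩ q , ((x , r⊆p∩q x∈r) , p , q , P , Q , refl) , r⊆p∩q

module Classes {_~_ : Rel (Fin n) 0ℓ} (isDecEquivalence : IsDecEquivalence _~_) where
  private module ~ = IsDecEquivalence isDecEquivalence

  class : Fin n → Subset n
  class x = tabulate λ y → ⌊ x ~.≟ y ⌋

  ∈-class⁺ : ∀ {x y} → x ~ y → y ∈ˢ class x
  ∈-class⁺ {x} {y} x~y = lookup⇒[]= y (class x)
    (trans (lookup∘tabulate _ y)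
           (Equivalence.to T-≡ (fromWitness {a? = x ~.≟ y} x~y)))

  ∈-class⁻ : ∀ {x y} → y ∈ˢ class x → x ~ y
  ∈-class⁻ {x} {y} y∈ = toWitness {a? = x ~.≟ y}
    (Equivalence.from T-≡ (trans (sym (lookup∘tabulate _ y)) ([]=⇒lookup y∈)))

  partition : Partition n
  partition = record
    { IsBlock  = λ p → ∃ λ x → p ≡ class x
    ; nonempty = λ { (x , refl) → x , ∈-class⁺ ~.refl }
    ; cover    = λ x → class x , (x , refl) , ∈-class⁺ ~.refl
    ; disjoint = λ { (x , refl) (y , refl) (z , z∈) →
        let z∈x , z∈y = x∈p∩q⁻ (class x) (class y) z∈
            x~y = ~.trans (∈-class⁻ z∈x) (~.sym (∈-class⁻ z∈y))
        in  ⊆-antisym (λ u∈ → ∈-class⁺ (~.trans (~.sym x~y) (∈-class⁻ u∈)))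
                      (λ u∈ → ∈-class⁺ (~.trans x~y (∈-class⁻ u∈))) }
    }

blockOf : Partition n → Fin n → Subset n
blockOf π x = proj₁ (Partition.cover π x)

Saturated : Partition n → Pred (Subset n) 0ℓ
Saturated π s = ∀ x → x ∈ˢ s → blockOf π x ⊆ˢ s

-- The join is built from the relation "x and y lie in the same subsets that are
-- unions of blocks of π and also unions of blocks of σ", which is decidable
-- without computing a transitive closure.
module Join (π σ : Partition n) where

  Stable : Pred (Subset n) 0ℓ
  Stable s = Saturated π s × Saturated σ s

  infix 4 _~_
  _~_ : Rel (Fin n) 0ℓ
  x ~ y = ∀ s → Stable s → x ∈ˢ s → y ∈ˢ s

  private
    self : ∀ (τ : Partition n) x → x ∈ˢ blockOf τ x
    self τ x = proj₂ (proj₂ (Partition.cover τ x))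

    blockOf-≡ : ∀ (τ : Partition n) {x y} → y ∈ˢ blockOf τ x → blockOf τ x ≡ blockOf τ y
    blockOf-≡ τ {x} {y} y∈ =
      Partition.same τ (proj₁ (proj₂ (Partition.cover τ x)))
                       (proj₁ (proj₂ (Partition.cover τ y))) y∈ (self τ y)

    saturated-∁ : ∀ (τ : Partition n) {s} → Saturated τ s → Saturated τ (∁ s)
    saturated-∁ τ {s} S x x∈∁s {y} y∈ = x∉p⇒x∈∁p λ y∈s →
      x∈∁p⇒x∉p x∈∁s (S y y∈s (subst (x ∈ˢ_) (blockOf-≡ τ y∈) (self τ x)))

    saturated? : ∀ (τ : Partition n) s → Dec (Saturated τ s)
    saturated? τ s = all? λ x → (x ∈? s) →-dec (blockOf τ x ⊆? s)
      where open import Data.Fin.Subset.Properties using (_⊆?_)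

    ~-sym : ∀ {x y} → x ~ y → y ~ x
    ~-sym {x} x~y s (S , S′) y∈s = decidable-stable (x ∈? s) λ x∉s →
      x∈p⇒x∉∁p y∈s
        (x~y (∁ s) (saturated-∁ π S , saturated-∁ σ S′) (x∉p⇒x∈∁p x∉s))

    _~?_ : Decidable _~_
    x ~? y = Dec.map′
      (λ ¬sep s S x∈s → decidable-stable (y ∈? s) λ y∉s → ¬sep (s , S , x∈s , y∉s))
      (λ x~y (s , S , x∈s , y∉s) → y∉s (x~y s S x∈s))
      (¬? (anySubset? λ s →
        (saturated? π s ×-dec saturated? σ s) ×-dec (x ∈? s) ×-dec ¬? (y ∈? s)))
      where import Relation.Nullary.Decidable.Core as Dec

  isDecEquivalence : IsDecEquivalence _~_
  isDecEquivalence = record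
    { isEquivalence = record
      { refl  = λ _ _ x∈s → x∈s
      ; sym   = ~-sym
      ; trans = λ x~y y~z s S → y~z s S ∘ x~y s S
      }
    ; _≟_ = _~?_
    }

  open Classes isDecEquivalence public

  private
    upper : ∀ (τ : Partition n) → (∀ {s} → Stable s → Saturated τ s) → τ ≤ partition
    upper τ sat {p} P with x , x∈p ← Partition.nonempty τ P =
      class x , (x , refl) , λ {y} y∈p → ∈-class⁺ λ s S x∈s →
        sat S x x∈s (subst (y ∈ˢ_) (p≡ x∈p) y∈p)
      where
      p≡ : ∀ {x} → x ∈ˢ p → p ≡ blockOf τ x
      p≡ {x} x∈p =
        Partition.same τ P (proj₁ (proj₂ (Partition.cover τ x))) x∈p (self τ x)

    block-saturated : ∀ (τ ρ : Partition n) → τ ≤ ρ →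
                      ∀ {r} → IsBlock ρ r → Saturated τ r
    block-saturated τ ρ τ≤ρ {r} R x x∈r
      with q , Q , b⊆q ← τ≤ρ (proj₁ (proj₂ (Partition.cover τ x)))
      with refl ← Partition.same ρ Q R (b⊆q (self τ x)) x∈r
      = b⊆q

  supremum : π ≤ partition × σ ≤ partition ×
             (∀ ρ → π ≤ ρ → σ ≤ ρ → partition ≤ ρ)
  supremum = upper π proj₁ , upper σ proj₂ , λ { ρ π≤ρ σ≤ρ (x , refl) →
    let r , R , x∈r = Partition.cover ρ x
    in  r , R , λ y∈ → ∈-class⁻ y∈ r
          (block-saturated π ρ π≤ρ R , block-saturated σ ρ σ≤ρ R) x∈r }

_∨_ : Op₂ (Partition n)
π ∨ σ = Join.partition π σ

∨-supremum : Supremum (_≤_ {n}) _∨_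
∨-supremum π σ = Join.supremum π σ

Part : ℕ → Lattice (suc 0ℓ) 0ℓ 0ℓ
Part n = record
  { Carrier   = Partition n
  ; _≈_       = _≈_
  ; _≤_       = _≤_
  ; _∨_       = _∨_
  ; _∧_       = _∧_
  ; isLattice = record
    { isPartialOrder = ≤-isPartialOrder
    ; supremum       = ∨-supremum
    ; infimum        = ∧-infimum
    }
  }

module _ {c ℓ₁ ℓ₂ ℓ : Level} (L : Lattice c ℓ₁ ℓ₂)
         (B : Pred (Lattice.Carrier L) ℓ) where

  private module L = Lattice L

  -- `respects` makes B a subset of the setoid carrier of L.
  record IsSublattice : Set (c ⊔ ℓ₁ ⊔ ℓ) where
    field
      respects : B Respects L._≈_
      ∨-closed : ∀ {x y} → x ∈ B → y ∈ B → x L.∨ y ∈ B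
      ∧-closed : ∀ {x y} → x ∈ B → y ∈ B → x L.∧ y ∈ B

    _≈ᴮ_ : Rel (Σ L.Carrier B) ℓ₁
    _≈ᴮ_ = L._≈_ on proj₁

    _∨ᴮ_ : Op₂ (Σ L.Carrier B)
    (x , x∈B) ∨ᴮ (y , y∈B) = x L.∨ y , ∨-closed x∈B y∈B

    _∧ᴮ_ : Op₂ (Σ L.Carrier B)
    (x , x∈B) ∧ᴮ (y , y∈B) = x L.∧ y , ∧-closed x∈B y∈B

  record IsBooleanSublattice : Set (c ⊔ ℓ₁ ⊔ ℓ) where
    field
      isSublattice : IsSublattice
    open IsSublattice isSublattice public

    -- ⊤ᴮ and ⊥ᴮ belong to B and need not be the bounds of L.
    field
      ¬ᴮ               : Op₁ (Σ L.Carrier B)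
      ⊤ᴮ ⊥ᴮ            : Σ L.Carrier B
      isBooleanAlgebra : IsBooleanAlgebra _≈ᴮ_ _∨ᴮ_ _∧ᴮ_ ¬ᴮ ⊤ᴮ ⊥ᴮ

{-# OPTIONS --safe #-}
-- If c ≰ ⊤ᴮ, and b ↦ b ∨ c preserves meets of elements of B and satisfies
-- (b ∨ c) ∧ b′ = b ∧ b′, then B ∪ {b ∨ c ∣ b ∈ B} is a copy of B × Bool.
-- If ⊤ᴮ ≠ ∇, let {p , q} be the only nontrivial block of c, where p and q lie in
-- different blocks of ⊤ᴮ.  If ⊥ᴮ ≠ △, argue in the dual lattice with
-- d = {{x} , U ∖ {x}}, where x shares its block of ⊥ᴮ with some y ≢ x: a chain of
-- blocks of members of B that passes through x can be rerouted through y.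
module Submission where

open import Defs hiding (_≈_; _≤_; _∧_; _∨_)
open import Data.Nat.Base using (ℕ; NonZero)
open import Data.Product.Base using (∃; _×_)
open import Level using (Level)
open import Relation.Unary using (Pred; _∈_; _∉_; _⊂_)

open import Algebra.Lattice.Bundles using (BooleanAlgebra)
import Algebra.Lattice.Properties.BooleanAlgebra as BooleanAlgebraProperties
open import Algebra.Lattice.Structures.Biased
  using (isBooleanAlgebraʳ; isDistributiveLatticeʳʲᵐ)
import Algebra.Lattice.Structures as Alg
open import Data.Bool.Base using (Bool; true; false; not) renaming (_∧_ to _and_; _∨_ to _or_)
import Data.Bool.Properties as Bool
open import Data.Fin.Base using (Fin)
open import Data.Fin.Properties using (_≟_; all?; ¬∀⟶∃¬)
open import Data.Fin.Subset using () renaming (_∈_ to _∈ˢ_)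
open import Data.Fin.Subset.Properties using (_∈?_; x∈p∩q⁺; x∈p∩q⁻)
open import Data.Product.Base using (Σ; _,_; proj₁; proj₂; swap)
open import Data.Sum.Base as Sum using (_⊎_; inj₁; inj₂)
open import Function.Base using (_∘_; _on_)
open import Level using (0ℓ; _⊔_)
open import Relation.Binary.Core using (Rel)
import Relation.Binary.Construct.On as On
open import Relation.Binary.Definitions using (Decidable)
open import Relation.Binary.Lattice.Bundles using (Lattice)
import Relation.Binary.Lattice.Properties.JoinSemilattice as JoinProperties
import Relation.Binary.Lattice.Properties.Lattice as LatticeProperties
import Relation.Binary.Lattice.Properties.MeetSemilattice as MeetProperties
open import Relation.Binary.PropositionalEquality.Core
  using (_≡_; _≢_; refl; sym; trans; subst; cong)
import Relation.Binary.PropositionalEquality.Properties as ≡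
import Relation.Binary.Reasoning.PartialOrder as PartialOrderReasoning
import Relation.Binary.Reasoning.Setoid as SetoidReasoning
open import Relation.Binary.Structures using (IsDecEquivalence)
open import Relation.Nullary using (¬_; Dec; yes; no; does; contradiction)
open import Relation.Nullary.Decidable
  using (_×-dec_; _⊎-dec_; _→-dec_; decidable-stable; dec-true; dec-false)

-- Boolean sublattices of an arbitrary lattice: bounds and duality.

module _ {a ℓ₁ ℓ₂ ℓ} {L : Lattice a ℓ₁ ℓ₂} {B : Pred (Lattice.Carrier L) ℓ} where

  module _ (S : IsSublattice L B) where

    open IsSublattice S
    open Alg.IsLattice (LatticeProperties.isAlgLattice L)

    isLatticeᴮ : Alg.IsLattice _≈ᴮ_ _∨ᴮ_ _∧ᴮ_
    isLatticeᴮ = record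
      { isEquivalence = On.isEquivalence proj₁ isEquivalence
      ; ∨-comm        = λ x y → ∨-comm (proj₁ x) (proj₁ y)
      ; ∨-assoc       = λ x y z → ∨-assoc (proj₁ x) (proj₁ y) (proj₁ z)
      ; ∨-cong        = ∨-cong
      ; ∧-comm        = λ x y → ∧-comm (proj₁ x) (proj₁ y)
      ; ∧-assoc       = λ x y z → ∧-assoc (proj₁ x) (proj₁ y) (proj₁ z)
      ; ∧-cong        = ∧-cong
      ; absorptive    = (λ x y → ∨-absorbs-∧ (proj₁ x) (proj₁ y))
                      , (λ x y → ∧-absorbs-∨ (proj₁ x) (proj₁ y))
      }

  module _ (S : IsBooleanSublattice L B) where

    open Lattice L
    open IsBooleanSublattice S

    booleanAlgebraᴮ : BooleanAlgebra (a ⊔ ℓ) ℓ₁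
    booleanAlgebraᴮ = record { isBooleanAlgebra = isBooleanAlgebra }

    open BooleanAlgebraProperties booleanAlgebraᴮ
      using (∧-identityʳ; ∨-identityʳ; ∧-∨-isBooleanAlgebra)

    ≤⊤ᴮ : ∀ {b} → b ∈ B → b ≤ proj₁ ⊤ᴮ
    ≤⊤ᴮ {b} b∈B = ≤-respˡ-≈ (∧-identityʳ (b , b∈B)) (x∧y≤y b _)

    ⊥ᴮ≤ : ∀ {b} → b ∈ B → proj₁ ⊥ᴮ ≤ b
    ⊥ᴮ≤ {b} b∈B = ≤-respʳ-≈ (∨-identityʳ (b , b∈B)) (y≤x∨y b _)

    dual : IsBooleanSublattice (LatticeProperties.∧-∨-lattice L) B
    dual = record
      { isSublattice = record
        { respects = respects ; ∨-closed = ∧-closed ; ∧-closed = ∨-closed }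
      ; ¬ᴮ = ¬ᴮ ; ⊤ᴮ = ⊥ᴮ ; ⊥ᴮ = ⊤ᴮ
      ; isBooleanAlgebra = ∧-∨-isBooleanAlgebra
      }

-- Stated over any lattice so that it can also be instantiated at the dual of `Part n`. The first
-- two fields ask for one inequality each; the remaining halves of the corresponding equations hold
-- in every lattice.
record IsTransversal {a ℓ₁ ℓ₂ ℓ} (L : Lattice a ℓ₁ ℓ₂) (B : Pred (Lattice.Carrier L) ℓ)
                     (S : IsBooleanSublattice L B) (c : Lattice.Carrier L) : Set (a ⊔ ℓ₂ ⊔ ℓ) where
  open Lattice L
  open IsBooleanSublattice S
  field
    ∨c-∧-∨c : ∀ {x y} → x ∈ B → y ∈ B → (x ∨ c) ∧ (y ∨ c) ≤ (x ∧ y) ∨ c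
    ∨c-∧    : ∀ {x y} → x ∈ B → y ∈ B → (x ∨ c) ∧ y ≤ x
    c≰⊤     : ¬ c ≤ proj₁ ⊤ᴮ

-- Adjoining a transversal element.

module Extension
  {a ℓ₁ ℓ₂ ℓ} {L : Lattice a ℓ₁ ℓ₂} {B : Pred (Lattice.Carrier L) ℓ}
  {S : IsBooleanSublattice L B} {c : Lattice.Carrier L} (isTransversal : IsTransversal L B S c)
  where

  open Lattice L hiding (refl) renaming (trans to ≤-trans)
  open IsBooleanSublattice S
  open IsTransversal isTransversal
  open JoinProperties joinSemilattice using (∨-monotonic; ∨-idempotent)
  open MeetProperties meetSemilattice using (∧-monotonic)
  open Alg.IsLattice (LatticeProperties.isAlgLattice L)
    using (∨-cong; ∨-congˡ; ∨-congʳ; ∨-assoc; ∨-comm; ∧-cong; ∧-comm; ∧-congʳ)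
  open SetoidReasoning setoid
  private
    module BA = BooleanAlgebra (booleanAlgebraᴮ S)
    module BAP = BooleanAlgebraProperties (booleanAlgebraᴮ S)

    ⊤ : Carrier
    ⊤ = proj₁ ⊤ᴮ

    variable
      x y : Carrier
      i j : Bool

  -- The intended isomorphism from `B × Bool` onto the enlarged sublattice, with the `Bool`
  -- coordinate as a tag.
  adjoin : Bool → Carrier → Carrier
  adjoin false x = x
  adjoin true  x = x ∨ c

  adjoin-cong : i ≡ j → x ≈ y → adjoin i x ≈ adjoin j y
  adjoin-cong {false} refl x≈y = x≈y
  adjoin-cong {true}  refl x≈y = ∨-congʳ x≈y

  [x∨c]∨y≈[x∨y]∨c : ∀ x y → (x ∨ c) ∨ y ≈ (x ∨ y) ∨ c
  [x∨c]∨y≈[x∨y]∨c x y = begin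
    (x ∨ c) ∨ y ≈⟨ ∨-assoc x c y ⟩
    x ∨ (c ∨ y) ≈⟨ ∨-congˡ (∨-comm c y) ⟩
    x ∨ (y ∨ c) ≈⟨ ∨-assoc x y c ⟨
    (x ∨ y) ∨ c ∎

  adjoin-∨ : ∀ i j x y → adjoin i x ∨ adjoin j y ≈ adjoin (i or j) (x ∨ y)
  adjoin-∨ false false x y = Eq.refl
  adjoin-∨ false true  x y = Eq.sym (∨-assoc x y c)
  adjoin-∨ true  false x y = [x∨c]∨y≈[x∨y]∨c x y
  adjoin-∨ true  true  x y = begin
    (x ∨ c) ∨ (y ∨ c) ≈⟨ ∨-assoc (x ∨ c) y c ⟨
    ((x ∨ c) ∨ y) ∨ c ≈⟨ ∨-congʳ ([x∨c]∨y≈[x∨y]∨c x y) ⟩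
    ((x ∨ y) ∨ c) ∨ c ≈⟨ ∨-assoc (x ∨ y) c c ⟩
    (x ∨ y) ∨ (c ∨ c) ≈⟨ ∨-congˡ (∨-idempotent c) ⟩
    (x ∨ y) ∨ c       ∎

  [x∨c]∧y≈x∧y : x ∈ B → y ∈ B → (x ∨ c) ∧ y ≈ x ∧ y
  [x∨c]∧y≈x∧y X Y = antisym
    (∧-greatest (∨c-∧ X Y) (x∧y≤y _ _))
    (∧-monotonic (x≤x∨y _ _) (reflexive Eq.refl))

  -- Joins respect tags in any lattice, but meets do so only on `B`: this is where the
  -- transversality inequalities enter.
  adjoin-∧ : ∀ i j → x ∈ B → y ∈ B → adjoin i x ∧ adjoin j y ≈ adjoin (i and j) (x ∧ y)
  adjoin-∧ false false X Y = Eq.refl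
  adjoin-∧ {x} {y} false true X Y = begin
    x ∧ (y ∨ c) ≈⟨ ∧-comm x (y ∨ c) ⟩
    (y ∨ c) ∧ x ≈⟨ [x∨c]∧y≈x∧y Y X ⟩
    y ∧ x       ≈⟨ ∧-comm y x ⟩
    x ∧ y       ∎
  adjoin-∧ true false X Y = [x∨c]∧y≈x∧y X Y
  adjoin-∧ true true  X Y = antisym (∨c-∧-∨c X Y) (∧-greatest
    (∨-monotonic (x∧y≤x _ _) (reflexive Eq.refl))
    (∨-monotonic (x∧y≤y _ _) (reflexive Eq.refl)))

  ∨c≰B : y ∈ B → ¬ x ∨ c ≤ y
  ∨c≰B Y x∨c≤y = c≰⊤ (≤-trans (y≤x∨y _ _) (≤-trans x∨c≤y (≤⊤ᴮ S Y)))

  -- The complement flips the tag stored in a membership proof, so it respects `≈` only if equal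
  -- elements carry equal tags. An element with tag `true` is never below a member of `B`, which
  -- separates the two tags.
  adjoin-injective : ∀ i j → x ∈ B → y ∈ B → adjoin i x ≈ adjoin j y → i ≡ j
  adjoin-injective false false _ _ _  = refl
  adjoin-injective false true  X _ eq = contradiction (reflexive (Eq.sym eq)) (∨c≰B X)
  adjoin-injective true  false _ Y eq = contradiction (reflexive eq) (∨c≰B Y)
  adjoin-injective true  true  _ _ _  = refl

  -- The elements b and b ∨ c for b ∈ B.  Reading b off as x ∧ ⊤ instead of
  -- quantifying over it keeps the predicate at the level of B.
  B⁺ : Pred Carrier (ℓ₁ ⊔ ℓ)
  B⁺ x = x ∧ ⊤ ∈ B × ∃ λ i → x ≈ adjoin i (x ∧ ⊤)

  -- `⊤` has tag `false`, so meeting with it erases `c` and recovers the `B` coordinate. Hence any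
  -- representation `adjoin i y` with `y` in `B` proves membership in `B⁺`.
  adjoin-∧-⊤ : ∀ i → x ∈ B → adjoin i x ∧ ⊤ ≈ x
  adjoin-∧-⊤ {x} i X = begin
    adjoin i x ∧ ⊤               ≈⟨ adjoin-∧ i false X (proj₂ ⊤ᴮ) ⟩
    adjoin (i and false) (x ∧ ⊤) ≈⟨ adjoin-cong (Bool.∧-zeroʳ i) (BAP.∧-identityʳ (x , X)) ⟩
    x                            ∎

  ∈B⁺ : ∀ i → y ∈ B → x ≈ adjoin i y → x ∈ B⁺
  ∈B⁺ {y} {x} i Y eq =
    respects (Eq.sym x∧⊤≈y) Y , i , Eq.trans eq (adjoin-cong {i} refl (Eq.sym x∧⊤≈y))
    where
    x∧⊤≈y : x ∧ ⊤ ≈ y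
    x∧⊤≈y = Eq.trans (∧-congʳ eq) (adjoin-∧-⊤ i Y)

  isSublattice⁺ : IsSublattice L B⁺
  isSublattice⁺ = record
    { respects = λ { x≈y (X , i , eq) → ∈B⁺ i X (Eq.trans (Eq.sym x≈y) eq) }
    ; ∨-closed = λ { (X , i , x≈) (Y , j , y≈) →
        ∈B⁺ (i or j) (∨-closed X Y) (Eq.trans (∨-cong x≈ y≈) (adjoin-∨ i j _ _)) }
    ; ∧-closed = λ { (X , i , x≈) (Y , j , y≈) →
        ∈B⁺ (i and j) (∧-closed X Y) (Eq.trans (∧-cong x≈ y≈) (adjoin-∧ i j X Y)) }
    }

  open IsSublattice isSublattice⁺ using () renaming (_≈ᴮ_ to _≈⁺_; _∨ᴮ_ to _∨⁺_; _∧ᴮ_ to _∧⁺_)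

  ⊤⁺ ⊥⁺ : Σ Carrier B⁺
  ⊤⁺ = ⊤ ∨ c , ∈B⁺ true (proj₂ ⊤ᴮ) Eq.refl
  ⊥⁺ = proj₁ ⊥ᴮ , ∈B⁺ false (proj₂ ⊥ᴮ) Eq.refl

  ¬⁺ : Σ Carrier B⁺ → Σ Carrier B⁺
  ¬⁺ (x , X , i , _) =
    adjoin (not i) (proj₁ (¬ᴮ (_ , X))) , ∈B⁺ (not i) (proj₂ (¬ᴮ (_ , X))) Eq.refl

  -- Both sides normalise to a single `adjoin`; the law then holds coordinatewise, in `Bool` for the
  -- tags and in `B` for the elements.
  ∨⁺-distribʳ-∧⁺ : ∀ x y z → ((y ∧⁺ z) ∨⁺ x) ≈⁺ ((y ∨⁺ x) ∧⁺ (z ∨⁺ x))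
  ∨⁺-distribʳ-∧⁺ (x , X , i , x≈) (y , Y , j , y≈) (z , Z , k , z≈) = begin
    (y ∧ z) ∨ x
      ≈⟨ ∨-cong (∧-cong y≈ z≈) x≈ ⟩
    (adjoin j y′ ∧ adjoin k z′) ∨ adjoin i x′
      ≈⟨ ∨-congʳ (adjoin-∧ j k Y Z) ⟩
    adjoin (j and k) (y′ ∧ z′) ∨ adjoin i x′
      ≈⟨ adjoin-∨ (j and k) i _ _ ⟩
    adjoin ((j and k) or i) ((y′ ∧ z′) ∨ x′)
      ≈⟨ adjoin-cong (Bool.∨-distribʳ-∧ i j k) (BA.∨-distribʳ-∧ (_ , X) (_ , Y) (_ , Z)) ⟩
    adjoin ((j or i) and (k or i)) ((y′ ∨ x′) ∧ (z′ ∨ x′))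
      ≈⟨ adjoin-∧ (j or i) (k or i) (∨-closed Y X) (∨-closed Z X) ⟨
    adjoin (j or i) (y′ ∨ x′) ∧ adjoin (k or i) (z′ ∨ x′)
      ≈⟨ ∧-cong (adjoin-∨ j i _ _) (adjoin-∨ k i _ _) ⟨
    (adjoin j y′ ∨ adjoin i x′) ∧ (adjoin k z′ ∨ adjoin i x′)
      ≈⟨ ∧-cong (∨-cong y≈ x≈) (∨-cong z≈ x≈) ⟨
    (y ∨ x) ∧ (z ∨ x)
      ∎
    where
    x′ = x ∧ ⊤
    y′ = y ∧ ⊤
    z′ = z ∧ ⊤

  isBooleanSublattice⁺ : IsBooleanSublattice L B⁺
  isBooleanSublattice⁺ = record
    { isSublattice = isSublattice⁺
    ; ¬ᴮ = ¬⁺ ; ⊤ᴮ = ⊤⁺ ; ⊥ᴮ = ⊥⁺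
    ; isBooleanAlgebra = isBooleanAlgebraʳ (record
      { isDistributiveLattice = isDistributiveLatticeʳʲᵐ (record
        { isLattice    = isLatticeᴮ isSublattice⁺
        ; ∨-distribʳ-∧ = ∨⁺-distribʳ-∧⁺
        })
      ; ∨-complementʳ = λ { (x , X , i , x≈) → Eq.trans (∨-congʳ x≈) (Eq.trans
          (adjoin-∨ i (not i) _ _)
          (adjoin-cong (Bool.∨-inverseʳ i) (BA.∨-complementʳ (_ , X)))) }
      ; ∧-complementʳ = λ { (x , X , i , x≈) → Eq.trans (∧-congʳ x≈) (Eq.trans
          (adjoin-∧ i (not i) X (proj₂ (¬ᴮ (_ , X))))
          (adjoin-cong (Bool.∧-inverseʳ i) (BA.∧-complementʳ (_ , X)))) }
      ; ¬-cong = λ { {x , X , i , x≈} {y , Y , j , y≈} x≈y →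
          adjoin-cong
            (cong not (adjoin-injective i j X Y (Eq.trans (Eq.sym x≈) (Eq.trans x≈y y≈))))
            (BA.¬-cong (∧-congʳ x≈y)) }
      })
    }

  B⊂B⁺ : B ⊂ B⁺
  B⊂B⁺ = (λ X → ∈B⁺ false X Eq.refl)
       -- The element `⊤ ∨ c` witnesses strictness.
       , λ B⁺⊆B → ∨c≰B (B⁺⊆B (proj₂ ⊤⁺)) (reflexive Eq.refl)

-- Partitions as decidable equivalence relations.

open Defs using (_≈_; _≤_; _∧_; _∨_)
open Partition using (IsBlock; cover; nonempty; same)

private
  variable
    n : ℕ

-- Using the block chosen by `cover` makes the relation decidable as subset membership, although
-- `IsBlock` itself is an arbitrary predicate. Disjointness of blocks makes it symmetric and
-- transitive.
SameBlock : Partition n → Rel (Fin n) 0ℓ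
SameBlock π u v = v ∈ˢ blockOf π u

module _ (π : Partition n) where

  blockOf-isBlock : ∀ u → IsBlock π (blockOf π u)
  blockOf-isBlock u = proj₁ (proj₂ (cover π u))

  SameBlock-refl : ∀ {u} → SameBlock π u u
  SameBlock-refl {u} = proj₂ (proj₂ (cover π u))

  IsBlock⇒SameBlock : ∀ {b u v} → IsBlock π b → u ∈ˢ b → v ∈ˢ b → SameBlock π u v
  IsBlock⇒SameBlock {u = u} {v} isBlock u∈b v∈b =
    subst (v ∈ˢ_) (same π isBlock (blockOf-isBlock u) u∈b SameBlock-refl) v∈b

  SameBlock-sym : ∀ {u v} → SameBlock π u v → SameBlock π v u
  SameBlock-sym {u} u~v = IsBlock⇒SameBlock (blockOf-isBlock u) u~v SameBlock-refl

  SameBlock-trans : ∀ {u v w} → SameBlock π u v → SameBlock π v w → SameBlock π u w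
  SameBlock-trans {v = v} u~v v~w =
    IsBlock⇒SameBlock (blockOf-isBlock v) (SameBlock-sym u~v) v~w

  sameBlock? : Decidable (SameBlock π)
  sameBlock? u v = v ∈? blockOf π u

module _ (π ρ : Partition n) where

  ≤⇒SameBlock : π ≤ ρ → ∀ {u v} → SameBlock π u v → SameBlock ρ u v
  ≤⇒SameBlock π≤ρ {u} u~v with _ , isBlock , ⊆ ← π≤ρ (blockOf-isBlock π u) =
    IsBlock⇒SameBlock ρ isBlock (⊆ (SameBlock-refl π)) (⊆ u~v)

  SameBlock⇒≤ : (∀ {u v} → SameBlock π u v → SameBlock ρ u v) → π ≤ ρ
  SameBlock⇒≤ f isBlock with x , x∈b ← nonempty π isBlock =
    blockOf ρ x , blockOf-isBlock ρ x , λ v∈b → f (IsBlock⇒SameBlock π isBlock x∈b v∈b)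

  -- The block that `cover` chooses in a meet is by definition the intersection of the two chosen
  -- blocks.
  SameBlock-∧⁺ : ∀ {u v} → SameBlock π u v → SameBlock ρ u v → SameBlock (π ∧ ρ) u v
  SameBlock-∧⁺ π∋ ρ∋ = x∈p∩q⁺ (π∋ , ρ∋)

  SameBlock-∧⁻ : ∀ {u v} → SameBlock (π ∧ ρ) u v → SameBlock π u v × SameBlock ρ u v
  SameBlock-∧⁻ = x∈p∩q⁻ _ _

∇-SameBlock⇒≈ : .{{_ : NonZero n}} (π : Partition n) →
                (∀ u v → SameBlock π u v) → ∇ ≈ π
∇-SameBlock⇒≈ {n} π all~ = antisym {∇} {π} (SameBlock⇒≤ ∇ π λ _ → all~ _ _) (∇-maximum π)
  where open Lattice (Part n) using (antisym)

△-SameBlock⇒≈ : (π : Partition n) → (∀ u v → SameBlock π u v → u ≡ v) → △ ≈ π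
△-SameBlock⇒≈ {n} π ~⇒≡ = antisym {△} {π} (△-minimum π) (SameBlock⇒≤ π △ λ {u} {v} u~v →
    subst (SameBlock △ u) (~⇒≡ u v u~v) (SameBlock-refl △))
  where open Lattice (Part n) using (antisym)

-- Merging the blocks of two points.

module Merge (π : Partition n) (p q : Fin n) where

  Merged : Pred (Fin n) 0ℓ
  Merged u = SameBlock π p u ⊎ SameBlock π q u

  infix 4 _~_
  -- The equivalence generated by `π` and the pair `p`, `q`. At most two blocks are fused, so it has
  -- a closed form without chains.
  _~_ : Rel (Fin n) 0ℓ
  u ~ v = SameBlock π u v ⊎ (Merged u × Merged v)

  merged-resp : ∀ {u v} → SameBlock π u v → Merged u → Merged v
  merged-resp u~v =
    Sum.map (λ p~u → SameBlock-trans π p~u u~v) (λ q~u → SameBlock-trans π q~u u~v)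

  ~-trans : ∀ {u v w} → u ~ v → v ~ w → u ~ w
  ~-trans (inj₁ u~v)       (inj₁ v~w)       = inj₁ (SameBlock-trans π u~v v~w)
  ~-trans (inj₁ u~v)       (inj₂ (mv , mw)) = inj₂ (merged-resp (SameBlock-sym π u~v) mv , mw)
  ~-trans (inj₂ (mu , mv)) (inj₁ v~w)       = inj₂ (mu , merged-resp v~w mv)
  ~-trans (inj₂ (mu , _))  (inj₂ (_ , mw))  = inj₂ (mu , mw)

  merged? : ∀ u → Dec (Merged u)
  merged? u = sameBlock? π p u ⊎-dec sameBlock? π q u

  isDecEquivalence : IsDecEquivalence _~_
  isDecEquivalence = record
    { isEquivalence = record
      { refl  = inj₁ (SameBlock-refl π)
      ; sym   = Sum.map (SameBlock-sym π) swap
      ; trans = ~-trans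
      }
    ; _≟_ = λ u v → sameBlock? π u v ⊎-dec (merged? u ×-dec merged? v)
    }

  open Classes isDecEquivalence public
    renaming (partition to merge; ∈-class⁺ to SameBlock⁺; ∈-class⁻ to SameBlock⁻)

  π≤merge : π ≤ merge
  π≤merge = SameBlock⇒≤ π merge (SameBlock⁺ ∘ inj₁)

  p~q : SameBlock merge p q
  p~q = SameBlock⁺ (inj₂ (inj₁ (SameBlock-refl π) , inj₂ (SameBlock-refl π)))

  -- Once `ρ` relates `p` to `q`, every merged point falls into the `ρ`-block of `p`.
  merge-least : ∀ ρ → π ≤ ρ → SameBlock ρ p q → merge ≤ ρ
  merge-least ρ π≤ρ p~q = SameBlock⇒≤ merge ρ (go ∘ SameBlock⁻)
    where
    fromMerged : ∀ {u} → Merged u → SameBlock ρ p u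
    fromMerged (inj₁ p~u) = ≤⇒SameBlock π ρ π≤ρ p~u
    fromMerged (inj₂ q~u) = SameBlock-trans ρ p~q (≤⇒SameBlock π ρ π≤ρ q~u)

    go : ∀ {u v} → u ~ v → SameBlock ρ u v
    go (inj₁ u~v)       = ≤⇒SameBlock π ρ π≤ρ u~v
    go (inj₂ (mu , mv)) = SameBlock-trans ρ (SameBlock-sym ρ (fromMerged mu)) (fromMerged mv)

open Merge using (merge; Merged)

module _ (π : Partition n) (p q : Fin n) where

  open Lattice (Part n) using (x≤x∨y; y≤x∨y; ∨-least)

  -- With the converse below, this replaces joins with `merge △ p q` by the explicit relation of
  -- `merge π p q`, so that later arguments are case analyses.
  ∨-merge-△≤merge : π ∨ merge △ p q ≤ merge π p q
  ∨-merge-△≤merge = ∨-least {π} {merge △ p q} {merge π p q} (Merge.π≤merge π p q)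
    (Merge.merge-least △ p q (merge π p q) (△-minimum (merge π p q)) (Merge.p~q π p q))

  merge≤∨-merge-△ : merge π p q ≤ π ∨ merge △ p q
  merge≤∨-merge-△ = Merge.merge-least π p q (π ∨ merge △ p q) (x≤x∨y π (merge △ p q))
    (≤⇒SameBlock (merge △ p q) (π ∨ merge △ p q) (y≤x∨y π (merge △ p q)) (Merge.p~q △ p q))

-- Transversality of a pair separated by an upper bound.

module _ (τ : Partition n) {p q : Fin n} (p≁q : ¬ SameBlock τ p q) where

  -- The only new pairs in `merge π p q` straddle the blocks of `p` and `q`. If `ρ` related such a
  -- pair, the path from `p` through it to `q` would lie inside `τ`.
  merge-∧≤ : ∀ π ρ → π ≤ τ → ρ ≤ τ → merge π p q ∧ ρ ≤ π
  merge-∧≤ π ρ π≤τ ρ≤τ = SameBlock⇒≤ (merge π p q ∧ ρ) π λ u~v →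
    let m , r = SameBlock-∧⁻ (merge π p q) ρ u~v in go (Merge.SameBlock⁻ π p q m) r
    where
    go : ∀ {u v} → Merge._~_ π p q u v → SameBlock ρ u v → SameBlock π u v
    go (inj₁ u~v) _ = u~v
    go (inj₂ (inj₁ p~u , inj₁ p~v)) _ = SameBlock-trans π (SameBlock-sym π p~u) p~v
    go (inj₂ (inj₂ q~u , inj₂ q~v)) _ = SameBlock-trans π (SameBlock-sym π q~u) q~v
    go (inj₂ (inj₁ p~u , inj₂ q~v)) r = contradiction
      (SameBlock-trans τ (≤⇒SameBlock π τ π≤τ p~u) (SameBlock-trans τ (≤⇒SameBlock ρ τ ρ≤τ r)
        (SameBlock-sym τ (≤⇒SameBlock π τ π≤τ q~v)))) p≁q
    go (inj₂ (inj₂ q~u , inj₁ p~v)) r = contradiction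
      (SameBlock-trans τ (≤⇒SameBlock π τ π≤τ p~v) (SameBlock-trans τ
        (SameBlock-sym τ (≤⇒SameBlock ρ τ ρ≤τ r))
        (SameBlock-sym τ (≤⇒SameBlock π τ π≤τ q~u)))) p≁q

  -- If one side relates the pair without merging, `merge-∧≤` removes the merging on the other side.
  -- If both merge, each endpoint is attached to the same one of `p` and `q` in `π` and in `ρ`,
  -- since otherwise `τ` would relate `p` to `q`.
  merge-∧-merge≤ : ∀ π ρ → π ≤ τ → ρ ≤ τ → merge π p q ∧ merge ρ p q ≤ merge (π ∧ ρ) p q
  merge-∧-merge≤ π ρ π≤τ ρ≤τ =
    SameBlock⇒≤ (merge π p q ∧ merge ρ p q) (merge (π ∧ ρ) p q) λ u~v →
    let m , m′ = SameBlock-∧⁻ (merge π p q) (merge ρ p q) u~v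
    in  go (Merge.SameBlock⁻ π p q m) (Merge.SameBlock⁻ ρ p q m′)
    where
    merged-∧ : ∀ {u} → Merged π p q u → Merged ρ p q u → Merged (π ∧ ρ) p q u
    merged-∧ (inj₁ p~u) (inj₁ p~′u) = inj₁ (SameBlock-∧⁺ π ρ p~u p~′u)
    merged-∧ (inj₂ q~u) (inj₂ q~′u) = inj₂ (SameBlock-∧⁺ π ρ q~u q~′u)
    merged-∧ (inj₁ p~u) (inj₂ q~′u) = contradiction (SameBlock-trans τ (≤⇒SameBlock π τ π≤τ p~u)
      (SameBlock-sym τ (≤⇒SameBlock ρ τ ρ≤τ q~′u))) p≁q
    merged-∧ (inj₂ q~u) (inj₁ p~′u) = contradiction (SameBlock-trans τ (≤⇒SameBlock ρ τ ρ≤τ p~′u)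
      (SameBlock-sym τ (≤⇒SameBlock π τ π≤τ q~u))) p≁q

    ~π : ∀ {u v} → Merge._~_ π p q u v → SameBlock ρ u v → SameBlock (merge (π ∧ ρ) p q) u v
    ~π m r = Merge.SameBlock⁺ (π ∧ ρ) p q (inj₁ (SameBlock-∧⁺ π ρ
      (≤⇒SameBlock (merge π p q ∧ ρ) π (merge-∧≤ π ρ π≤τ ρ≤τ)
        (SameBlock-∧⁺ (merge π p q) ρ (Merge.SameBlock⁺ π p q m) r)) r))

    ~ρ : ∀ {u v} → SameBlock π u v → Merge._~_ ρ p q u v → SameBlock (merge (π ∧ ρ) p q) u v
    ~ρ r m = Merge.SameBlock⁺ (π ∧ ρ) p q (inj₁ (SameBlock-∧⁺ π ρ r
      (≤⇒SameBlock (merge ρ p q ∧ π) ρ (merge-∧≤ ρ π ρ≤τ π≤τ)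
        (SameBlock-∧⁺ (merge ρ p q) π (Merge.SameBlock⁺ ρ p q m) r))))

    go : ∀ {u v} → Merge._~_ π p q u v → Merge._~_ ρ p q u v → SameBlock (merge (π ∧ ρ) p q) u v
    go m (inj₁ r) = ~π m r
    go (inj₁ r) m = ~ρ r m
    go (inj₂ (mu , mv)) (inj₂ (mu′ , mv′)) =
      Merge.SameBlock⁺ (π ∧ ρ) p q (inj₂ (merged-∧ mu mu′ , merged-∧ mv mv′))

-- Splitting off a single point.

module Isolate (x : Fin n) where

  -- The kernel of the indicator function of `x`. Building the partition from classes avoids
  -- treating an empty complement of `x` separately.
  isolate-isDecEquivalence : IsDecEquivalence (_≡_ on λ u → does (x ≟ u))
  isolate-isDecEquivalence = On.isDecEquivalence _ (≡.isDecEquivalence Bool._≟_)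

  open Classes isolate-isDecEquivalence public renaming (partition to isolate)

  SameBlock-isolate⁺ : ∀ {u v} → x ≢ u → x ≢ v → SameBlock isolate u v
  SameBlock-isolate⁺ x≢u x≢v =
    ∈-class⁺ (trans (dec-false (x ≟ _) x≢u) (sym (dec-false (x ≟ _) x≢v)))

  SameBlock-isolate⁻ : ∀ {v} → SameBlock isolate x v → x ≡ v
  SameBlock-isolate⁻ {v} x~v = dec-true⁻ (trans (sym (∈-class⁻ x~v)) (dec-true (x ≟ x) refl))
    where
    dec-true⁻ : does (x ≟ v) ≡ true → x ≡ v
    dec-true⁻ eq with yes x≡v ← x ≟ v = x≡v

open Isolate using (isolate)

-- Dual transversality of an isolated point.

module _ {x y : Fin n} (x≢y : x ≢ y) where

  open Lattice (Part n) using (x≤x∨y; y≤x∨y; ∨-least; x∧y≤y) renaming (trans to ≤-trans)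

  -- The rerouting argument: pairs avoiding `x` survive the meet with `isolate x` and so lie in `κ`.
  -- A pair of `x` and another point `v` is replaced by `y` and `v`, which avoid `x`; merging `x`
  -- with `y` restores the original pair.
  ≤merge : ∀ π κ → SameBlock π x y → π ∧ isolate x ≤ κ → π ≤ merge κ x y
  ≤merge π κ x~y π∧d≤κ = SameBlock⇒≤ π (merge κ x y) go
    where
    toκ : ∀ {u v} → x ≢ u → x ≢ v → SameBlock π u v → SameBlock κ u v
    toκ x≢u x≢v u~v = ≤⇒SameBlock (π ∧ isolate x) κ π∧d≤κ
      (SameBlock-∧⁺ π (isolate x) u~v (Isolate.SameBlock-isolate⁺ x x≢u x≢v))

    fromx : ∀ {v} → x ≢ v → SameBlock π x v → SameBlock (merge κ x y) x v
    fromx x≢v x~v = Merge.SameBlock⁺ κ x y (inj₂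
      ( inj₁ (SameBlock-refl κ)
      , inj₂ (toκ x≢y x≢v (SameBlock-trans π (SameBlock-sym π x~y) x~v))))

    go : ∀ {u v} → SameBlock π u v → SameBlock (merge κ x y) u v
    go {u} {v} u~v with x ≟ u | x ≟ v
    ... | yes refl | yes refl = SameBlock-refl (merge κ x y)
    ... | yes refl | no x≢v   = fromx x≢v u~v
    ... | no x≢u   | yes refl = SameBlock-sym (merge κ x y) (fromx x≢u (SameBlock-sym π u~v))
    ... | no x≢u   | no x≢v   = Merge.SameBlock⁺ κ x y (inj₁ (toκ x≢u x≢v u~v))

  ≤∧-isolate-∨ : ∀ π ρ → SameBlock π x y → SameBlock ρ x y → π ≤ (π ∧ isolate x) ∨ ρ
  ≤∧-isolate-∨ π ρ x~y x~′y = ≤-trans {π} {merge κ x y} {κ}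
    (≤merge π κ x~y (x≤x∨y (π ∧ isolate x) ρ))
    -- Here `ρ`, and therefore `κ`, already relates `x` to `y`, so the merge adds nothing.
    (Merge.merge-least κ x y κ (Lattice.refl (Part n) {κ})
      (≤⇒SameBlock ρ κ (y≤x∨y (π ∧ isolate x) ρ) x~′y))
    where κ = (π ∧ isolate x) ∨ ρ

  -- Both `π` and `ρ` lie below `merge κ x y`, hence so does their join, with no chain to follow.
  -- Since `x` is alone in `κ`, this merge only attaches `x` to the block of `y`, and meeting with
  -- `isolate x` detaches it again.
  ∨-∧-isolate≤ : ∀ π ρ → SameBlock π x y → SameBlock ρ x y →
                 (π ∨ ρ) ∧ isolate x ≤ (π ∧ isolate x) ∨ (ρ ∧ isolate x)
  ∨-∧-isolate≤ π ρ x~y x~′y = SameBlock⇒≤ ((π ∨ ρ) ∧ d) κ λ u~v →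
    let j , d∋ = SameBlock-∧⁻ (π ∨ ρ) d u~v
    in  go (Merge.SameBlock⁻ κ x y (≤⇒SameBlock (π ∨ ρ) (merge κ x y) π∨ρ≤ j)) d∋
    where
    d κ : Partition n
    d = isolate x
    κ = (π ∧ d) ∨ (ρ ∧ d)

    κ≤d : κ ≤ d
    κ≤d = ∨-least {π ∧ d} {ρ ∧ d} {d} (x∧y≤y π d) (x∧y≤y ρ d)

    π∨ρ≤ : π ∨ ρ ≤ merge κ x y
    π∨ρ≤ = ∨-least {π} {ρ} {merge κ x y}
      (≤merge π κ x~y (x≤x∨y (π ∧ d) (ρ ∧ d)))
      (≤merge ρ κ x~′y (y≤x∨y (π ∧ d) (ρ ∧ d)))

    -- As `κ ≤ d`, the first hypothesis forces `u` to be `x`, and the second then forces `v` to be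
    -- `x`.
    isolated : ∀ {u v} → SameBlock κ x u → SameBlock d u v → SameBlock κ u v
    isolated x~u u~v
      with x~′u ← ≤⇒SameBlock κ d κ≤d x~u
      with refl ← Isolate.SameBlock-isolate⁻ x x~′u
      with refl ← Isolate.SameBlock-isolate⁻ x u~v
      = SameBlock-refl κ

    go : ∀ {u v} → Merge._~_ κ x y u v → SameBlock d u v → SameBlock κ u v
    go (inj₁ u~v) _ = u~v
    go (inj₂ (inj₁ x~u , _)) u~v = isolated x~u u~v
    go (inj₂ (_ , inj₁ x~v)) u~v = SameBlock-sym κ (isolated x~v (SameBlock-sym d u~v))
    go (inj₂ (inj₂ y~u , inj₂ y~v)) _ = SameBlock-trans κ (SameBlock-sym κ y~u) y~v

-- Finding the two points by finite search.

separated : (π : Partition n) .{{_ : NonZero n}} → ¬ ∇ ≈ π → ∃ λ p → ∃ λ q → ¬ SameBlock π p q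
separated {n} π ∇≉π =
  let p , ¬all = ¬∀⟶∃¬ n _ (λ u → all? (sameBlock? π u)) (∇≉π ∘ ∇-SameBlock⇒≈ π)
  in  p , ¬∀⟶∃¬ n _ (sameBlock? π p) ¬all

joined : (π : Partition n) → ¬ △ ≈ π → ∃ λ x → ∃ λ y → SameBlock π x y × x ≢ y
joined {n} π △≉π =
  let x , ¬all = ¬∀⟶∃¬ n _ (λ u → all? (λ v → ~⇒≡? u v)) (△≉π ∘ △-SameBlock⇒≈ π)
      y , ¬imp = ¬∀⟶∃¬ n _ (~⇒≡? x) ¬all
  -- A refuted implication yields its premise only up to double negation, which decidability of
  -- `SameBlock` removes.
  in  x , y , decidable-stable (sameBlock? π x y) (λ x≁y → ¬imp (λ x~y → contradiction x~y x≁y))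
    , λ x≡y → ¬imp (λ _ → x≡y)
  where
  ~⇒≡? : ∀ u v → Dec (SameBlock π u v → u ≡ v)
  ~⇒≡? u v = sameBlock? π u v →-dec (u ≟ v)

-- The extensions above and below.

module _ {ℓ} (B : Pred (Partition n) ℓ) (S : IsBooleanSublattice (Part n) B) where

  open IsBooleanSublattice S
  open MeetProperties (Lattice.meetSemilattice (Part n)) using (∧-monotonic)
  open Lattice (Part n) using (poset) renaming (refl to ≤-refl)
  open PartialOrderReasoning poset

  extend-above : .{{_ : NonZero n}} → ∇ ∉ B →
                 ∃ λ (B′ : Pred (Partition n) ℓ) → IsBooleanSublattice (Part n) B′ × B ⊂ B′
  extend-above ∇∉B
    with p , q , p≁q ← separated (proj₁ ⊤ᴮ) (λ ∇≈⊤ → ∇∉B (respects (swap ∇≈⊤) (proj₂ ⊤ᴮ))) =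
    B⁺ , isBooleanSublattice⁺ , B⊂B⁺
    where
    c : Partition n
    c = merge △ p q

    ∨c≤ : ∀ π → π ∨ c ≤ merge π p q
    ∨c≤ π = ∨-merge-△≤merge π p q

    isTransversal : IsTransversal (Part n) B S c
    isTransversal = record
      { ∨c-∧-∨c = λ {π} {ρ} π∈B ρ∈B → begin
          (π ∨ c) ∧ (ρ ∨ c)
            ≤⟨ ∧-monotonic {merge π p q} {π ∨ c} {merge ρ p q} {ρ ∨ c} (∨c≤ π) (∨c≤ ρ) ⟩
          merge π p q ∧ merge ρ p q
            ≤⟨ merge-∧-merge≤ (proj₁ ⊤ᴮ) p≁q π ρ (≤⊤ᴮ S π∈B) (≤⊤ᴮ S ρ∈B) ⟩
          merge (π ∧ ρ) p q
            ≤⟨ merge≤∨-merge-△ (π ∧ ρ) p q ⟩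
          (π ∧ ρ) ∨ c
            ∎
      ; ∨c-∧ = λ {π} {ρ} π∈B ρ∈B → begin
          (π ∨ c) ∧ ρ
            ≤⟨ ∧-monotonic {merge π p q} {π ∨ c} {ρ} {ρ} (∨c≤ π) (≤-refl {ρ}) ⟩
          merge π p q ∧ ρ
            ≤⟨ merge-∧≤ (proj₁ ⊤ᴮ) p≁q π ρ (≤⊤ᴮ S π∈B) (≤⊤ᴮ S ρ∈B) ⟩
          π
            ∎
      ; c≰⊤ = λ c≤⊤ → p≁q (≤⇒SameBlock c (proj₁ ⊤ᴮ) c≤⊤ (Merge.p~q △ p q))
      }

    open Extension isTransversal

  extend-below : △ ∉ B →
                 ∃ λ (B′ : Pred (Partition n) ℓ) → IsBooleanSublattice (Part n) B′ × B ⊂ B′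
  extend-below △∉B
    with x , y , x~y , x≢y ← joined (proj₁ ⊥ᴮ) (λ △≈⊥ → △∉B (respects (swap △≈⊥) (proj₂ ⊥ᴮ))) =
    -- The extension is Boolean in the dual lattice; dualising again restores the operations of
    -- `Part n` definitionally.
    B⁺ , dual isBooleanSublattice⁺ , B⊂B⁺
    where
    x~y-in : ∀ {π} → π ∈ B → SameBlock π x y
    x~y-in {π} π∈B = ≤⇒SameBlock (proj₁ ⊥ᴮ) π (⊥ᴮ≤ S π∈B) x~y

    -- In the dual, joining with `c` means meeting with `isolate x` and every inequality is
    -- reversed; `c≰⊤` says that `⊥ᴮ` is not below `isolate x`.
    isTransversal : IsTransversal (LatticeProperties.∧-∨-lattice (Part n)) B (dual S) (isolate x)
    isTransversal = record
      { ∨c-∧-∨c = λ {π} {ρ} π∈B ρ∈B → ∨-∧-isolate≤ x≢y π ρ (x~y-in π∈B) (x~y-in ρ∈B)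
      ; ∨c-∧    = λ {π} {ρ} π∈B ρ∈B → ≤∧-isolate-∨ x≢y π ρ (x~y-in π∈B) (x~y-in ρ∈B)
      ; c≰⊤     = λ ⊥≤d → x≢y (Isolate.SameBlock-isolate⁻ x
          (≤⇒SameBlock (proj₁ ⊥ᴮ) (isolate x) ⊥≤d x~y))
      }

    open Extension isTransversal

proposition2p2 : ∀ (n : ℕ) .{{_ : NonZero n}} {ℓ : Level} (B : Pred (Partition n) ℓ) →
    IsBooleanSublattice (Part n) B →
    (∇ ∉ B → ∃ λ (B′ : Pred (Partition n) ℓ) → IsBooleanSublattice (Part n) B′ × B ⊂ B′)
    × (∇ ∈ B → △ ∉ B → ∃ λ (B′ : Pred (Partition n) ℓ) → IsBooleanSublattice (Part n) B′ × B ⊂ B′)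
proposition2p2 n B S = extend-above B S , λ _ → extend-below B S
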